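{- Let $m,n$ be nonnegative integers with $p=2m+n\geq 2$. Let $G$ be a simple graph with $\chi_{(m,n)}(G)=k\geq 4$. Then the acyclic chromatic number of $G$ satisfies $\chi_a(G)\leq k^2+k^{2+\lceil \log_2\log_p k\rceil}$.
   Context: An $(m,n)$-colored mixed graph is a graph whose connections are either arcs, each colored with one of $m$ colors $\alpha_1,\dots,\alpha_m$, or edges, each colored with one of $n$ colors $\beta_1,\dots,\beta_n$, such that the underlying undirected graph (forgetting orientations and colors) is simple. A colored homomorphism of $G$ to $H$ is a vertex map sending each arc (resp. edge) of $G$ to an arc (resp. edge) of $H$ of the same color, preserving arc direction. For an $(m,n)$-colored mixed graph $G$, $\chi_{(m,n)}(G)$ is the minimum number of vertices of an $(m,n)$-colored mixed graph $H$ such that $G$ admits a colored homomorphism to $H$. For a simple undirected graph $G$, $\chi_{(m,n)}(G)$ is the maximum of $\chi_{(m,n)}(G')$ over all $(m,n)$-colored mixed graphs $G'$ with underlying graph $G$. An acyclic coloring is a proper vertex coloring in which any two color classes induce a forest; $\chi_a(G)$ is the minimum number of colors in an acyclic coloring of $G$. -}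

module Defs where

open import Data.Nat using (ℕ; zero; suc; _+_; _∸_; _^_; _≤_; _<_)
open import Data.Integer as ℤ using (ℤ; +_; -[1+_])
open import Data.Fin using (Fin; zero; suc; inject₁; fromℕ)
open import Data.Product using (Σ; _×_; ∃; ∃-syntax)
open import Data.Sum using (_⊎_)
open import Relation.Nullary using (¬_)
open import Relation.Binary.PropositionalEquality using (_≡_; _≢_)
open import Function.Definitions using (Injective)
open import Function.Bundles using (_⇔_)

record SimpleGraph (N : ℕ) : Set₁ where
  field
    Adj     : Fin N → Fin N → Set
    sym     : ∀ {u v} → Adj u v → Adj v u
    irrefl  : ∀ {u} → ¬ Adj u u

open SimpleGraph public

-- (m,n)-colored mixed graphs on Fin N.
-- lab u v = none        : u, v not adjacent
-- lab u v = arcOut i    : arc of colour α_i from u to v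
-- lab u v = arcIn  i    : arc of colour α_i from v to u
-- lab u v = edge j      : edge of colour β_j between u and v

data Label (m n : ℕ) : Set where
  none   : Label m n
  arcOut : Fin m → Label m n
  arcIn  : Fin m → Label m n
  edge   : Fin n → Label m n

rev : ∀ {m n} → Label m n → Label m n
rev none       = none
rev (arcOut i) = arcIn i
rev (arcIn i)  = arcOut i
rev (edge j)   = edge j

record MixedGraph (m n N : ℕ) : Set where
  field
    lab     : Fin N → Fin N → Label m n
    lab-rev : ∀ u v → lab v u ≡ rev (lab u v)
    lab-irr : ∀ u → lab u u ≡ none

open MixedGraph public

Hom : ∀ {m n N M} → MixedGraph m n N → MixedGraph m n M → Set
Hom {N = N} {M} G H =
  Σ (Fin N → Fin M) λ f →
    ∀ u v → lab G u v ≢ none → lab H (f u) (f v) ≡ lab G u v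

HomToSize : ∀ {m n N} → MixedGraph m n N → ℕ → Set
HomToSize {m} {n} G M = Σ (MixedGraph m n M) λ H → Hom G H

IsLeast : (ℕ → Set) → ℕ → Set
IsLeast P k = P k × (∀ j → P j → k ≤ j)

ChiMixedIs : ∀ {m n N} → MixedGraph m n N → ℕ → Set
ChiMixedIs G k = IsLeast (HomToSize G) k

Underlying : ∀ {m n N} → MixedGraph m n N → SimpleGraph N → Set
Underlying G' G = ∀ u v → (lab G' u v ≢ none) ⇔ Adj G u v

ChiIs : ∀ (m n : ℕ) {N} → SimpleGraph N → ℕ → Set
ChiIs m n {N} G k =
  (Σ (MixedGraph m n N) λ G' → Underlying G' G × ChiMixedIs G' k)
  × (∀ (G' : MixedGraph m n N) → Underlying G' G → ∀ j → ChiMixedIs G' j → j ≤ k)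

record Cycle {N : ℕ} (G : SimpleGraph N) : Set where
  field
    len   : ℕ
    vs    : Fin (3 + len) → Fin N
    inj   : Injective _≡_ _≡_ vs
    step  : ∀ (i : Fin (2 + len)) → Adj G (vs (inject₁ i)) (vs (suc i))
    close : Adj G (vs (fromℕ (2 + len))) (vs zero)

open Cycle public

IsAcyclicColoring : ∀ {N} (G : SimpleGraph N) (c : ℕ) → (Fin N → Fin c) → Set
IsAcyclicColoring {N} G c col =
  (∀ u v → Adj G u v → col u ≢ col v)
  × (∀ (a b : Fin c) → ¬ (Σ (Cycle G) λ C →
        ∀ i → (col (vs C i) ≡ a) ⊎ (col (vs C i) ≡ b)))

AcyclicChiLe : ∀ {N} → SimpleGraph N → ℕ → Set
AcyclicChiLe {N} G B = Σ ℕ λ c → c ≤ B × Σ (Fin N → Fin c) (IsAcyclicColoring G c)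

-- ⌈log₂ log_p k⌉ as an integer t: the least integer t with p^(2^t) ≥ k.
-- For t = + a this reads k ≤ p^(2^a); for t = -(s+1) it reads k^(2^(s+1)) ≤ p.

CeilCond : ℕ → ℕ → ℤ → Set
CeilCond p k (+ a)      = k ≤ p ^ (2 ^ a)
CeilCond p k -[1+ s ]   = k ^ (2 ^ suc s) ≤ p

IsCeilLog2LogP : ℕ → ℕ → ℤ → Set
IsCeilLog2LogP p k t = CeilCond p k t × ¬ CeilCond p k (t ℤ.- + 1)

-- ⌊k^e⌋ for integer exponent e and k ≥ 2 (negative exponents give 0)
floorPow : ℕ → ℤ → ℕ
floorPow k (+ e)     = k ^ e
floorPow k -[1+ _ ]  = 0

{-# OPTIONS --safe #-}
module Submission where

-- Let p = 2m + n and let q = 2^t with k ≤ p^q. Every labelling of G maps to a target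
-- with k vertices, so counting labellings against targets shows that s vertices
-- spanning d ordered adjacent pairs satisfy p^d ≤ p^(k²) k^(2s). Hence any s > k²
-- vertices contain one with at most 2q neighbours among them. Peel off such vertices
-- until a core of at most k² vertices is left, which receive private colours. Number
-- the edges from each peeled vertex to the vertices still present by 0, …, 2q − 1:
-- each number class is a forest outside the core. The t + 1 bits of the number, used
-- as labels, give t + 1 homomorphisms, and one further homomorphism controls the
-- orientation; their product is a colouring with k^(t+2) colours in which the edges of
-- a bicoloured cycle all lie in one class.
-- If t < 0 then k² ≤ p, so there are enough colours to label k²/2 edges differently;
-- thus G has fewer edges than that, and its non-isolated vertices all receive
-- different colours.

open import Defs
open import Data.Nat using (ℕ; _+_; _*_; _^_; _≤_)
open import Data.Integer as ℤ using (ℤ; +_)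
open import Data.Integer using (-[1+_])
open import Data.Nat using (zero; suc; _<_; z≤n; s≤s; s≤s⁻¹; >-nonZero)
import Data.Nat.Properties as ℕ
open import Data.Nat.DivMod using (_/_; _%_; m≡m%n+[m/n]*n; m%n<n)
open import Data.Nat.Tactic.RingSolver using (solve-∀)
open import Data.Fin as Fin using (Fin; zero; suc; toℕ; fromℕ; inject₁; inject≤; splitAt; _↑ˡ_; _↑ʳ_; combine; remQuot; funToFin; finToFun; punchIn; punchOut)
open import Data.Fin.Properties
open import Data.Fin.Relation.Unary.Top using (view; ‵fromℕ; ‵inj₁; view-fromℕ; view-inject₁)
open import Data.Maybe using (Maybe; just; nothing)
open import Data.Maybe.Properties using (just-injective)
open import Data.Product using (Σ; ∃; _×_; _,_; proj₁; proj₂)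
open import Data.Sum using (_⊎_; inj₁; inj₂)
open import Data.Empty using (⊥; ⊥-elim)
open import Function using (_∘_; id)
open import Function.Bundles using (mk⇔; Equivalence)
open import Function.Definitions using (Injective)
open import Relation.Nullary using (¬_; Dec; yes; no; contradiction; ¬?)
open import Relation.Nullary.Decidable using (map′; _×-dec_; _→-dec_)
open import Relation.Binary.Definitions using (tri<; tri≈; tri>)
open import Relation.Binary.PropositionalEquality renaming (sym to ≡-sym)

-- Labels

module _ {m n : ℕ} where

  _≟ᴸ_ : (x y : Label m n) → Dec (x ≡ y)
  none     ≟ᴸ none     = yes refl
  none     ≟ᴸ arcOut _ = no λ ()
  none     ≟ᴸ arcIn _  = no λ ()
  none     ≟ᴸ edge _   = no λ ()
  arcOut _ ≟ᴸ none     = no λ ()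
  arcOut i ≟ᴸ arcOut j = map′ (cong arcOut) (λ { refl → refl }) (i ≟ j)
  arcOut _ ≟ᴸ arcIn _  = no λ ()
  arcOut _ ≟ᴸ edge _   = no λ ()
  arcIn _  ≟ᴸ none     = no λ ()
  arcIn _  ≟ᴸ arcOut _ = no λ ()
  arcIn i  ≟ᴸ arcIn j  = map′ (cong arcIn) (λ { refl → refl }) (i ≟ j)
  arcIn _  ≟ᴸ edge _   = no λ ()
  edge _   ≟ᴸ none     = no λ ()
  edge _   ≟ᴸ arcOut _ = no λ ()
  edge _   ≟ᴸ arcIn _  = no λ ()
  edge i   ≟ᴸ edge j   = map′ (cong edge) (λ { refl → refl }) (i ≟ j)

  rev-involutive : (x : Label m n) → rev (rev x) ≡ x
  rev-involutive none       = refl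
  rev-involutive (arcOut _) = refl
  rev-involutive (arcIn _)  = refl
  rev-involutive (edge _)   = refl

  rev-injective : {x y : Label m n} → rev x ≡ rev y → x ≡ y
  rev-injective {x} {y} eq =
    trans (≡-sym (rev-involutive x)) (trans (cong rev eq) (rev-involutive y))

  rev-≢none : {x : Label m n} → x ≢ none → rev x ≢ none
  rev-≢none x≢none eq = x≢none (rev-injective eq)

  -- Seen from one end of an ordered pair, an arc colour gives two labels, hence `2 * m + n`; here
  -- `2 * m` unfolds to `m + (m + 0)`. The junk value `d` at `none` makes the map total.
  encode : Fin (2 * m + n) → Label m n → Fin (2 * m + n)
  encode d none       = d
  encode d (arcOut i) = (i ↑ˡ (m + 0)) ↑ˡ n
  encode d (arcIn i)  = (m ↑ʳ (i ↑ˡ 0)) ↑ˡ n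
  encode d (edge j)   = (2 * m) ↑ʳ j

  decodeArc : Fin m ⊎ Fin (m + 0) → Label m n
  decodeArc (inj₁ i) = arcOut i
  decodeArc (inj₂ i) with splitAt m i
  ... | inj₁ j = arcIn j

  decode⊎ : Fin (2 * m) ⊎ Fin n → Label m n
  decode⊎ (inj₁ i) = decodeArc (splitAt m i)
  decode⊎ (inj₂ j) = edge j

  decode : Fin (2 * m + n) → Label m n
  decode = decode⊎ ∘ splitAt (2 * m)

  decode-encode : ∀ d x → x ≢ none → decode (encode d x) ≡ x
  decode-encode d none       x≢none = contradiction refl x≢none
  decode-encode d (arcOut i) _
    rewrite splitAt-↑ˡ (2 * m) (i ↑ˡ (m + 0)) n | splitAt-↑ˡ m i (m + 0) = refl
  decode-encode d (arcIn i)  _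
    rewrite splitAt-↑ˡ (2 * m) (m ↑ʳ (i ↑ˡ 0)) n | splitAt-↑ʳ m (m + 0) (i ↑ˡ 0) | splitAt-↑ˡ m i 0 = refl
  decode-encode d (edge j)   _
    rewrite splitAt-↑ʳ (2 * m) n j = refl

  decode-≢none : ∀ x → decode x ≢ none
  decode-≢none x eq with splitAt (2 * m) x
  decode-≢none x eq | inj₁ y with splitAt m y
  decode-≢none x eq | inj₁ y | inj₂ z with splitAt m z
  decode-≢none x () | inj₁ y | inj₂ z | inj₁ _

  encode-decode : ∀ d x → encode d (decode x) ≡ x
  encode-decode d x with splitAt (2 * m) x | join-splitAt (2 * m) n x
  ... | inj₂ j | eq = eq
  ... | inj₁ y | eq with splitAt m y | join-splitAt m (m + 0) y
  ...   | inj₁ i | eq′ = trans (cong (_↑ˡ n) eq′) eq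
  ...   | inj₂ z | eq′ with splitAt m z | join-splitAt m 0 z
  ...     | inj₁ i | eq″ = trans (cong (_↑ˡ n) (trans (cong (m ↑ʳ_) eq″) eq′)) eq

  encode-injective : ∀ d {x y} → x ≢ none → y ≢ none → encode d x ≡ encode d y → x ≡ y
  encode-injective d {x} {y} x≢ y≢ eq =
    trans (≡-sym (decode-encode d x x≢)) (trans (cong decode eq) (decode-encode d y y≢))

  decode-injective : ∀ d {x y} → decode x ≡ decode y → x ≡ y
  decode-injective d {x} {y} eq =
    trans (≡-sym (encode-decode d x)) (trans (cong (encode d) eq) (encode-decode d y))

least : {P : ℕ → Set} → (∀ j → Dec (P j)) → ∀ j → P j → ∃ (IsLeast P)
least {P} P? j pj with search (suc j)
  where
  search : ∀ b → ∃ (IsLeast P) ⊎ (∀ i → i < b → ¬ P i)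
  search zero = inj₂ λ _ ()
  search (suc b) with search b
  ... | inj₁ l = inj₁ l
  ... | inj₂ none<b with P? b
  ...   | yes pb = inj₁ (b , pb , λ i pi → ℕ.≮⇒≥ λ i<b → none<b i i<b pi)
  ...   | no ¬pb = inj₂ below
    where
    below : ∀ i → i < suc b → ¬ P i
    below i i<1+b pi with ℕ.m≤n⇒m<n∨m≡n (s≤s⁻¹ i<1+b)
    ... | inj₁ i<b  = none<b i i<b pi
    ... | inj₂ refl = ¬pb pi
... | inj₁ l = l
... | inj₂ none≤j = contradiction pj (none≤j j ℕ.≤-refl)

-- Homomorphisms from a fixed mixed graph

module _ {m n N : ℕ} (G : MixedGraph m n N) where

  Arc : Fin N → Fin N → Set
  Arc u v = lab G u v ≢ none

  arc? : ∀ u v → Dec (Arc u v)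
  arc? u v = ¬? (lab G u v ≟ᴸ none)

  arc-sym : ∀ {u v} → Arc u v → Arc v u
  arc-sym {u} {v} a eq = rev-≢none a (trans (≡-sym (lab-rev G u v)) eq)

  -- f is a homomorphism to some mixed graph on Fin M: the image of f can be
  -- given labels consistently, so no target needs to be mentioned.
  Consistent : ∀ {M} → (Fin N → Fin M) → Set
  Consistent f =
    (∀ u v → Arc u v → f u ≢ f v) ×
    (∀ u v u′ v′ → Arc u v → Arc u′ v′ → f u ≡ f u′ → f v ≡ f v′ → lab G u v ≡ lab G u′ v′)

  consistent? : ∀ {M} (f : Fin N → Fin M) → Dec (Consistent f)
  consistent? f =
    (all? λ u → all? λ v → arc? u v →-dec ¬? (f u ≟ f v)) ×-dec
    (all? λ u → all? λ v → all? λ u′ → all? λ v′ →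
      arc? u v →-dec (arc? u′ v′ →-dec ((f u ≟ f u′) →-dec ((f v ≟ f v′) →-dec
        (lab G u v ≟ᴸ lab G u′ v′)))))

  consistent-∘ : ∀ {M M′} (f : Fin N → Fin M) (g : Fin N → Fin M′) →
    (∀ u v → g u ≡ g v → f u ≡ f v) → Consistent f → Consistent g
  consistent-∘ f g reflects (proper , coherent) =
    (λ u v a → proper u v a ∘ reflects u v) ,
    (λ u v u′ v′ a a′ eq eq′ → coherent u v u′ v′ a a′ (reflects u u′ eq) (reflects v v′ eq′))

  hom⇒consistent : ∀ {M} → HomToSize G M → ∃ (Consistent {M})
  hom⇒consistent (H , f , hom) = f , proper , coherent
    where
    proper : ∀ u v → Arc u v → f u ≢ f v
    proper u v a eq = a (trans (≡-sym (hom u v a))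
      (trans (cong (λ x → lab H x (f v)) eq) (lab-irr H (f v))))
    coherent : ∀ u v u′ v′ → Arc u v → Arc u′ v′ → f u ≡ f u′ → f v ≡ f v′ → lab G u v ≡ lab G u′ v′
    coherent u v u′ v′ a a′ eq eq′ =
      trans (≡-sym (hom u v a)) (trans (cong₂ (lab H) eq eq′) (hom u′ v′ a′))

  module _ {M} (f : Fin N → Fin M) (cons : Consistent f) where

    Preimage : Fin M → Fin M → Set
    Preimage x y = ∃ λ u → ∃ λ v → Arc u v × f u ≡ x × f v ≡ y

    preimage? : ∀ x y → Dec (Preimage x y)
    preimage? x y = any? λ u → any? λ v → arc? u v ×-dec ((f u ≟ x) ×-dec (f v ≟ y))

    imageLab : ∀ {x y} → Dec (Preimage x y) → Label m n
    imageLab (yes (u , v , _)) = lab G u v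
    imageLab (no _)            = none

    imageLab-rev : ∀ {x y} (d : Dec (Preimage x y)) (d′ : Dec (Preimage y x)) →
      imageLab d′ ≡ rev (imageLab d)
    imageLab-rev (yes (u , v , a , p , q)) (yes (u′ , v′ , a′ , p′ , q′)) =
      trans (proj₂ cons u′ v′ v u a′ (arc-sym a) (trans p′ (≡-sym q)) (trans q′ (≡-sym p)))
            (lab-rev G u v)
    imageLab-rev (yes (u , v , a , p , q)) (no ¬p) = contradiction (v , u , arc-sym a , q , p) ¬p
    imageLab-rev (no ¬p) (yes (u , v , a , p , q)) = contradiction (v , u , arc-sym a , q , p) ¬p
    imageLab-rev (no _) (no _) = refl

    imageLab-irr : ∀ {x} (d : Dec (Preimage x x)) → imageLab d ≡ none
    imageLab-irr (yes (u , v , a , p , q)) = contradiction (trans p (≡-sym q)) (proj₁ cons u v a)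
    imageLab-irr (no _) = refl

    imageLab-hom : ∀ {u v} → Arc u v → (d : Dec (Preimage (f u) (f v))) → imageLab d ≡ lab G u v
    imageLab-hom {u} {v} a (yes (u′ , v′ , a′ , p , q)) = proj₂ cons u′ v′ u v a′ a p q
    imageLab-hom {u} {v} a (no ¬p) = contradiction (u , v , a , refl , refl) ¬p

    consistent⇒hom : HomToSize G M
    consistent⇒hom = image , f , λ u v a → imageLab-hom a (preimage? (f u) (f v))
      where
      image : MixedGraph m n M
      image = record
        { lab     = λ x y → imageLab (preimage? x y)
        ; lab-rev = λ x y → imageLab-rev (preimage? x y) (preimage? y x)
        ; lab-irr = λ x → imageLab-irr (preimage? x x)
        }

  -- Passing to `Consistent` removes the target from the search and leaves finitely many vertex
  -- maps, so a least size can be found constructively.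
  homToSize? : ∀ M → Dec (HomToSize G M)
  homToSize? M = map′
    (λ (z , c) → consistent⇒hom (finToFun z) c)
    (λ h → let (f , c) = hom⇒consistent h in
      funToFin f , consistent-∘ f (finToFun (funToFin f))
        (λ u v eq → trans (≡-sym (finToFun-funToFin f u)) (trans eq (finToFun-funToFin f v))) c)
    (any? {n = M ^ N} λ z → consistent? (finToFun z))

  homToSize-mono : ∀ {M M′} → M ≤ M′ → HomToSize G M → HomToSize G M′
  homToSize-mono M≤M′ h =
    let (f , c) = hom⇒consistent h in
    consistent⇒hom (λ u → inject≤ (f u) M≤M′)
      (consistent-∘ f _ (λ u v → inject≤-injective M≤M′ M≤M′ (f u) (f v)) c)

  chiMixed : ∃ (ChiMixedIs G)
  chiMixed = least homToSize? N (G , id , λ _ _ _ → refl)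

-- The maximum in `ChiIs` bounds only numbers that are least for some mixed graph, so the least size
-- for `G′` is produced first and then padded to `k`.
chiIs⇒homToSize : ∀ {m n N k} {G : SimpleGraph N} → ChiIs m n G k →
  ∀ G′ → Underlying G′ G → HomToSize G′ k
chiIs⇒homToSize (_ , max) G′ und =
  let (j , χ) = chiMixed G′ in homToSize-mono G′ (max G′ und j χ) (proj₁ χ)

-- `Adj` is an arbitrary relation; the mixed graph attaining the maximum decides it.
chiIs⇒adj? : ∀ {m n N k} {G : SimpleGraph N} → ChiIs m n G k → ∀ u v → Dec (Adj G u v)
chiIs⇒adj? ((G′ , und , _) , _) u v =
  map′ (Equivalence.to (und u v)) (Equivalence.from (und u v)) (arc? G′ u v)

-- Labelling the edges of G along the order of the vertices

module _ {m n N : ℕ} where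

  -- Only the values of `ℓ` on increasing pairs count; reversal forces the others, so every `ℓ`
  -- yields a valid labelling.
  orient : (Fin N → Fin N → Label m n) → Fin N → Fin N → Label m n
  orient ℓ u v with <-cmp u v
  ... | tri< _ _ _ = ℓ u v
  ... | tri≈ _ _ _ = none
  ... | tri> _ _ _ = rev (ℓ v u)

  orient-< : ∀ ℓ {u v} → u Fin.< v → orient ℓ u v ≡ ℓ u v
  orient-< ℓ {u} {v} u<v with <-cmp u v
  ... | tri< _ _ _   = refl
  ... | tri≈ u≮v _ _ = contradiction u<v u≮v
  ... | tri> u≮v _ _ = contradiction u<v u≮v

  orient-> : ∀ ℓ {u v} → v Fin.< u → orient ℓ u v ≡ rev (ℓ v u)
  orient-> ℓ {u} {v} v<u with <-cmp u v
  ... | tri< _ _ v≮u = contradiction v<u v≮u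
  ... | tri≈ _ _ v≮u = contradiction v<u v≮u
  ... | tri> _ _ _   = refl

  orient-refl : ∀ ℓ u → orient ℓ u u ≡ none
  orient-refl ℓ u with <-cmp u u
  ... | tri< _ u≢u _ = contradiction refl u≢u
  ... | tri≈ _ _ _   = refl
  ... | tri> _ u≢u _ = contradiction refl u≢u

  orient-rev : ∀ ℓ u v → orient ℓ v u ≡ rev (orient ℓ u v)
  orient-rev ℓ u v with <-cmp u v
  ... | tri< u<v _ _  = orient-> ℓ u<v
  ... | tri≈ _ refl _ = orient-refl ℓ u
  ... | tri> _ _ v<u  = trans (orient-< ℓ v<u) (≡-sym (rev-involutive (ℓ v u)))

  orient-≢none : ∀ ℓ → (∀ u v → ℓ u v ≢ none) → ∀ {u v} → u ≢ v → orient ℓ u v ≢ none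
  orient-≢none ℓ ℓ≢none {u} {v} u≢v with <-cmp u v
  ... | tri< _ _ _   = ℓ≢none u v
  ... | tri≈ _ u≡v _ = contradiction u≡v u≢v
  ... | tri> _ _ _   = rev-≢none (ℓ≢none v u)

Realization : ∀ {m n N} → SimpleGraph N → ℕ → (Fin N → Fin N → Label m n) → Set
Realization {m} {n} {N} G k ℓ =
  Σ (MixedGraph m n k) λ H → Σ (Fin N → Fin k) λ f →
    ∀ {u v} → Adj G u v → lab H (f u) (f v) ≡ orient ℓ u v

-- Together with decidable adjacency, this is all that the later bounds take from `ChiIs`.
Realizable : ∀ (m n : ℕ) {N} → SimpleGraph N → ℕ → Set
Realizable m n {N} G k =
  (ℓ : Fin N → Fin N → Label m n) → (∀ u v → ℓ u v ≢ none) → Realization G k ℓ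

adj⇒≢ : ∀ {N} (G : SimpleGraph N) {u v} → Adj G u v → u ≢ v
adj⇒≢ G a refl = irrefl G a

module _ {m n N k : ℕ} (G : SimpleGraph N) (chi : ChiIs m n G k) where

  restrict : ∀ {u v} → Dec (Adj G u v) → Label m n → Label m n
  restrict (yes _) x = x
  restrict (no _)  _ = none

  restrict-yes : ∀ {u v} (d : Dec (Adj G u v)) {x} → Adj G u v → restrict d x ≡ x
  restrict-yes (yes _) _ = refl
  restrict-yes (no ¬a) a = contradiction a ¬a

  restrict-rev : ∀ {u v} (d : Dec (Adj G u v)) (d′ : Dec (Adj G v u)) {x y} → y ≡ rev x →
    restrict d′ y ≡ rev (restrict d x)
  restrict-rev (yes _) (yes _) eq = eq
  restrict-rev (yes a) (no ¬a) _  = contradiction (sym G a) ¬a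
  restrict-rev (no ¬a) (yes a) _  = contradiction (sym G a) ¬a
  restrict-rev (no _)  (no _)  _  = refl

  restrict-none : ∀ {u v} (d : Dec (Adj G u v)) {x} → x ≡ none → restrict d x ≡ none
  restrict-none (yes _) eq = eq
  restrict-none (no _)  _  = refl

  restrict-≢none : ∀ {u v} (d : Dec (Adj G u v)) {x} → restrict d x ≢ none → Adj G u v
  restrict-≢none (yes a) _  = a
  restrict-≢none (no _)  ne = contradiction refl ne

  -- Labels off the edges of `G` are erased and those on the edges are never empty, so the
  -- underlying graph is exactly `G`.
  chiIs⇒realizable : Realizable m n G k
  chiIs⇒realizable ℓ ℓ≢none =
    let (H , f , hom) = chiIs⇒homToSize {G = G} chi G′ und in
    H , f , λ {u} {v} a → trans (hom u v (Equivalence.from (und u v) a)) (restrict-yes (adj? u v) a)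
    where
    adj? : ∀ u v → Dec (Adj G u v)
    adj? = chiIs⇒adj? {G = G} chi
    G′ : MixedGraph m n N
    G′ = record
      { lab     = λ u v → restrict (adj? u v) (orient ℓ u v)
      ; lab-rev = λ u v → restrict-rev (adj? u v) (adj? v u) (orient-rev ℓ u v)
      ; lab-irr = λ u → restrict-none (adj? u u) (orient-refl ℓ u)
      }
    und : Underlying G′ G
    und u v = mk⇔ (restrict-≢none (adj? u v)) λ a eq →
      orient-≢none ℓ ℓ≢none (adj⇒≢ G a) (trans (≡-sym (restrict-yes (adj? u v) a)) eq)

-- Functions between finite sets as numbers

funToFin-cong : ∀ {a b} {f g : Fin a → Fin b} → (∀ i → f i ≡ g i) → funToFin f ≡ funToFin g
funToFin-cong {zero}  _  = refl
funToFin-cong {suc a} eq = cong₂ combine (eq zero) (funToFin-cong (eq ∘ suc))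

funToFin-injective : ∀ {a b} {f g : Fin a → Fin b} → funToFin f ≡ funToFin g → ∀ i → f i ≡ g i
funToFin-injective {f = f} {g} eq i =
  trans (≡-sym (finToFun-funToFin f i)) (trans (cong (λ z → finToFun z i) eq) (finToFun-funToFin g i))

finToFun-injective : ∀ {a b} {x y : Fin (b ^ a)} → (∀ i → finToFun {b} {a} x i ≡ finToFun y i) → x ≡ y
finToFun-injective {a} {b} {x} {y} eq =
  trans (≡-sym (funToFin-finToFin {a} {b} x))
        (trans (funToFin-cong eq) (funToFin-finToFin {a} {b} y))

remQuot-injective : ∀ {a} b {x y : Fin (a * b)} → remQuot {a} b x ≡ remQuot b y → x ≡ y
remQuot-injective {a} b {x} {y} eq = trans (≡-sym (combine-remQuot {a} b x))
  (trans (cong (λ (i , j) → combine i j) eq) (combine-remQuot {a} b y))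

-- Separating edge classes by homomorphisms

-- One arc colour supplies two labels by its two directions; without arcs there are two edge
-- colours. The last clause serves pairs read in opposite directions: if `g zero` does not reveal
-- the direction, no label of `g` does.
TwoLabels : ℕ → ℕ → Set
TwoLabels m n = Σ (Fin 2 → Label m n) λ g →
  (∀ b → g b ≢ none) × Injective _≡_ _≡_ g × (g zero ≡ rev (g zero) → ∀ b → rev (g b) ≡ g b)

twoLabels : ∀ m n → 2 ≤ 2 * m + n → TwoLabels m n
twoLabels zero (suc (suc n)) _ =
  (λ b → edge (b ↑ˡ n)) , (λ _ ()) , (λ eq → ↑ˡ-injective n _ _ (edge-injective eq)) , λ _ _ → refl
  where
  edge-injective : ∀ {m n} {i j : Fin n} → edge {m} i ≡ edge j → i ≡ j
  edge-injective refl = refl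
twoLabels zero zero ()
twoLabels zero (suc zero) (s≤s ())
twoLabels (suc m) n _ = g , g≢none , (λ {x} {y} → g-injective x y) , λ ()
  where
  g : Fin 2 → Label (suc m) n
  g zero       = arcOut zero
  g (suc zero) = arcIn zero
  g≢none : ∀ b → g b ≢ none
  g≢none zero       ()
  g≢none (suc zero) ()
  g-injective : ∀ x y → g x ≡ g y → x ≡ y
  g-injective zero       zero       _  = refl
  g-injective zero       (suc zero) ()
  g-injective (suc zero) zero       ()
  g-injective (suc zero) (suc zero) _  = refl

module _ {m n N k : ℕ} (G : SimpleGraph N) (realize : Realizable m n G k) (p≥2 : 2 ≤ 2 * m + n) where

  -- One homomorphism per bit of the class, and one more for the constant
  -- labelling: the latter fixes the direction of the edge relative to the
  -- vertex order, without which an arc label does not determine the bit.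
  separate : ∀ {s} (X : Fin N → Fin N → Fin (2 ^ s)) → (∀ u v → X u v ≡ X v u) →
    Σ (Fin N → Fin (k ^ suc s)) λ col →
      (∀ {u v} → Adj G u v → col u ≢ col v) ×
      (∀ {u v v′} → Adj G u v → Adj G u v′ → col v ≡ col v′ → X u v ≡ X u v′)
  separate {s} X X-sym = col , proper , separates
    where
    g = proj₁ (twoLabels m n p≥2)
    g≢none = proj₁ (proj₂ (twoLabels m n p≥2))
    g-injective = proj₁ (proj₂ (proj₂ (twoLabels m n p≥2)))
    g-undirected = proj₂ (proj₂ (proj₂ (twoLabels m n p≥2)))

    bit : Fin (suc s) → Fin N → Fin N → Fin 2
    bit zero    u v = zero
    bit (suc i) u v = finToFun (X u v) i

    bit-sym : ∀ j u v → bit j u v ≡ bit j v u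
    bit-sym zero    u v = refl
    bit-sym (suc i) u v = cong (λ x → finToFun x i) (X-sym u v)

    ℓ : Fin (suc s) → Fin N → Fin N → Label m n
    ℓ j u v = g (bit j u v)

    real : ∀ j → Realization G k (ℓ j)
    real j = realize (ℓ j) λ u v → g≢none (bit j u v)

    col : Fin N → Fin (k ^ suc s)
    col u = funToFin λ j → proj₁ (proj₂ (real j)) u

    col-injective : ∀ {u v} → col u ≡ col v → ∀ j → proj₁ (proj₂ (real j)) u ≡ proj₁ (proj₂ (real j)) v
    col-injective {u} {v} =
      funToFin-injective {f = λ j → proj₁ (proj₂ (real j)) u} {λ j → proj₁ (proj₂ (real j)) v}

    proper : ∀ {u v} → Adj G u v → col u ≢ col v
    proper {u} {v} a eq =
      let (H , f , hom) = real zero in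
      orient-≢none (ℓ zero) (λ _ _ → g≢none zero) (adj⇒≢ G a)
        (trans (≡-sym (hom a))
          (trans (cong (λ x → lab H x (f v)) (col-injective eq zero)) (lab-irr H (f v))))

    separates : ∀ {u v v′} → Adj G u v → Adj G u v′ → col v ≡ col v′ → X u v ≡ X u v′
    separates {u} {v} {v′} a a′ eq = finToFun-injective {s} same-bit
      where
      same : ∀ j → orient (ℓ j) u v ≡ orient (ℓ j) u v′
      same j = let (H , f , hom) = real j in
        trans (≡-sym (hom a)) (trans (cong (lab H (f u)) (col-injective eq j)) (hom a′))

      forward : ∀ j {w} → u Fin.< w → orient (ℓ j) u w ≡ g (bit j u w)
      forward j u<w = orient-< (ℓ j) u<w

      backward : ∀ j {w} → w Fin.< u → orient (ℓ j) u w ≡ rev (g (bit j u w))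
      backward j {w} w<u = trans (orient-> (ℓ j) w<u) (cong (rev ∘ g) (bit-sym j w u))

      same-bit : ∀ i → bit (suc i) u v ≡ bit (suc i) u v′
      same-bit i with <-cmp u v | <-cmp u v′
      ... | tri≈ _ u≡v _ | _             = contradiction u≡v (adj⇒≢ G a)
      ... | _            | tri≈ _ u≡v′ _ = contradiction u≡v′ (adj⇒≢ G a′)
      ... | tri< lt _ _  | tri< lt′ _ _  =
        g-injective (trans (≡-sym (forward (suc i) lt)) (trans (same (suc i)) (forward (suc i) lt′)))
      ... | tri> _ _ gt  | tri> _ _ gt′  =
        g-injective (rev-injective
          (trans (≡-sym (backward (suc i) gt)) (trans (same (suc i)) (backward (suc i) gt′))))
      ... | tri< lt _ _  | tri> _ _ gt′  =
        g-injective (trans (≡-sym (forward (suc i) lt)) (trans (same (suc i))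
          (trans (backward (suc i) gt′)
            (g-undirected (trans (≡-sym (forward zero lt)) (trans (same zero) (backward zero gt′))) _))))
      ... | tri> _ _ gt  | tri< lt′ _ _  =
        g-injective (trans (≡-sym
          (g-undirected (trans (≡-sym (forward zero lt′)) (trans (≡-sym (same zero)) (backward zero gt))) _))
          (trans (≡-sym (backward (suc i) gt)) (trans (same (suc i)) (forward (suc i) lt′))))

-- Counting labellings

module _ {m n k : ℕ} (d : Fin (2 * m + n)) where

  entry : MixedGraph m n k → MixedGraph m n k → Fin k × Fin k → Fin (2 * m + n)
  entry H H′ (x , y) with x <? y
  ... | yes _ = encode d (lab H x y)
  ... | no _  = encode d (lab H′ x y)

  entry-upper : ∀ H H′ {x y} → x Fin.< y → entry H H′ (x , y) ≡ encode d (lab H x y)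
  entry-upper H H′ {x} {y} x<y with x <? y
  ... | yes _   = refl
  ... | no x≮y = contradiction x<y x≮y

  entry-lower : ∀ H H′ {x y} → y Fin.< x → entry H H′ (x , y) ≡ encode d (lab H′ x y)
  entry-lower H H′ {x} {y} y<x with x <? y
  ... | yes x<y = contradiction x<y (<-asym y<x)
  ... | no _    = refl

  table : MixedGraph m n k → MixedGraph m n k → Fin (k * k) → Fin (2 * m + n)
  table H H′ z = entry H H′ (remQuot k z)

  table-upper : ∀ H H′ {x y} → x Fin.< y → table H H′ (combine x y) ≡ encode d (lab H x y)
  table-upper H H′ {x} {y} x<y =
    trans (cong (entry H H′) (remQuot-combine x y)) (entry-upper H H′ x<y)

  table-lower : ∀ H H′ {x y} → y Fin.< x → table H H′ (combine x y) ≡ encode d (lab H′ x y)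
  table-lower H H′ {x} {y} y<x =
    trans (cong (entry H H′) (remQuot-combine x y)) (entry-lower H H′ y<x)

  -- By reversal, one of two opposite entries suffices. Both labels must be nonempty because
  -- `encode` gives `none` the code `d` of a genuine label.
  lab-determined : ∀ (H K : MixedGraph m n k) x y → lab H x y ≢ none → lab K x y ≢ none →
    encode d (lab H x y) ≡ encode d (lab K x y) ⊎ encode d (lab H y x) ≡ encode d (lab K y x) →
    lab H x y ≡ lab K x y
  lab-determined H K x y h≢ k≢ (inj₁ eq) = encode-injective d h≢ k≢ eq
  lab-determined H K x y h≢ k≢ (inj₂ eq) = rev-injective
    (trans (≡-sym (lab-rev H x y)) (trans (encode-injective d (flip H h≢) (flip K k≢) eq) (lab-rev K x y)))
    where
    flip : ∀ (H : MixedGraph m n k) → lab H x y ≢ none → lab H y x ≢ none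
    flip H ne eq = rev-≢none ne (trans (≡-sym (lab-rev H x y)) eq)

  module _ (H H′ K K′ : MixedGraph m n k) (same : ∀ z → table H H′ z ≡ table K K′ z) where

    table-determines-upper : ∀ {x y} → lab H x y ≢ none → lab K x y ≢ none → lab H x y ≡ lab K x y
    table-determines-upper {x} {y} h≢ k≢ with <-cmp x y
    ... | tri≈ _ refl _ = contradiction (lab-irr H x) h≢
    ... | tri< lt _ _ = lab-determined H K x y h≢ k≢
      (inj₁ (trans (≡-sym (table-upper H H′ lt)) (trans (same _) (table-upper K K′ lt))))
    ... | tri> _ _ gt = lab-determined H K x y h≢ k≢
      (inj₂ (trans (≡-sym (table-upper H H′ gt)) (trans (same _) (table-upper K K′ gt))))

    table-determines-lower : ∀ {x y} → lab H′ x y ≢ none → lab K′ x y ≢ none → lab H′ x y ≡ lab K′ x y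
    table-determines-lower {x} {y} h≢ k≢ with <-cmp x y
    ... | tri≈ _ refl _ = contradiction (lab-irr H′ x) h≢
    ... | tri> _ _ gt = lab-determined H′ K′ x y h≢ k≢
      (inj₁ (trans (≡-sym (table-lower H H′ gt)) (trans (same _) (table-lower K K′ gt))))
    ... | tri< lt _ _ = lab-determined H′ K′ x y h≢ k≢
      (inj₂ (trans (≡-sym (table-lower H H′ lt)) (trans (same _) (table-lower K K′ lt))))

-- Joint injectivity says that the indices stand for distinct ordered pairs, so the values there can
-- be prescribed independently.
module Extend {N E : ℕ} {A : Set} (src tgt : Fin E → Fin N)
  (jointly-injective : ∀ {x y} → src x ≡ src y → tgt x ≡ tgt y → x ≡ y) (default : A) where

  private
    Hit : Fin N → Fin N → Fin E → Set
    Hit u v y = src y ≡ u × tgt y ≡ v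

    extendDec : (φ : Fin E → A) → ∀ {u v} → Dec (∃ (Hit u v)) → A
    extendDec φ (yes (y , _)) = φ y
    extendDec φ (no _)        = default

    extendDec-hit : ∀ φ y (dec : Dec (∃ (Hit (src y) (tgt y)))) → extendDec φ dec ≡ φ y
    extendDec-hit φ y (yes (_ , p , q)) = cong φ (jointly-injective p q)
    extendDec-hit φ y (no ¬hit)         = contradiction (y , refl , refl) ¬hit

  extend : (Fin E → A) → Fin N → Fin N → A
  extend φ u v = extendDec φ (any? λ y → (src y ≟ u) ×-dec (tgt y ≟ v))

  extend-hit : ∀ φ y → extend φ (src y) (tgt y) ≡ φ y
  extend-hit φ y = extendDec-hit φ y (any? _)

module _ {m n N k : ℕ} (G : SimpleGraph N) (realize : Realizable m n G k) (d : Fin (2 * m + n))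
  {E s : ℕ} (e : Fin s → Fin N) (σ τ : Fin E → Fin s)
  (adj : ∀ y → Adj G (e (σ y)) (e (τ y)))
  (jointly-injective : ∀ {x y} → e (σ x) ≡ e (σ y) → e (τ x) ≡ e (τ y) → x ≡ y) where

  private
    p : ℕ
    p = 2 * m + n

    open Extend (e ∘ σ) (e ∘ τ) jointly-injective d

    up down : (Fin E → Fin p) → Fin N → Fin N → Label m n
    up   φ u v = decode (extend φ u v)
    -- `orient` reads a decreasing pair at its swap and reverses the result; swapping and reversing
    -- here undoes both.
    down φ u v = rev (decode (extend φ v u))

    upReal : ∀ φ → Realization G k (up φ)
    upReal φ = realize (up φ) λ u v → decode-≢none (extend φ u v)

    downReal : ∀ φ → Realization G k (down φ)
    downReal φ = realize (down φ) λ u v → rev-≢none (decode-≢none (extend φ v u))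

    upLab : ∀ φ y → e (σ y) Fin.< e (τ y) → let (H , f , _) = upReal φ in
      lab H (f (e (σ y))) (f (e (τ y))) ≡ decode (φ y)
    upLab φ y lt = trans (proj₂ (proj₂ (upReal φ)) (adj y))
      (trans (orient-< (up φ) lt) (cong decode (extend-hit φ y)))

    downLab : ∀ φ y → e (τ y) Fin.< e (σ y) → let (H , f , _) = downReal φ in
      lab H (f (e (σ y))) (f (e (τ y))) ≡ decode (φ y)
    downLab φ y gt = trans (proj₂ (proj₂ (downReal φ)) (adj y))
      (trans (orient-> (down φ) gt) (trans (rev-involutive _) (cong decode (extend-hit φ y))))

    -- Of each homomorphism only the images of the `s` vertices in `e` are kept, whence two factors
    -- `k ^ s`; the shared table accounts for `p ^ (k * k)`.
    code : (Fin E → Fin p) → Fin (p ^ (k * k) * (k ^ s * k ^ s))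
    code φ = let (H , f , _) = upReal φ ; (H′ , f′ , _) = downReal φ in
      combine (funToFin (table d H H′)) (combine (funToFin (f ∘ e)) (funToFin (f′ ∘ e)))

    code-injective : ∀ φ χ → code φ ≡ code χ → ∀ y → φ y ≡ χ y
    code-injective φ χ eq y = by-order
      where
      H  = proj₁ (upReal φ)
      f  = proj₁ (proj₂ (upReal φ))
      H′ = proj₁ (downReal φ)
      f′ = proj₁ (proj₂ (downReal φ))
      K  = proj₁ (upReal χ)
      g  = proj₁ (proj₂ (upReal χ))
      K′ = proj₁ (downReal χ)
      g′ = proj₁ (proj₂ (downReal χ))

      eqs = combine-injective (funToFin (table d H H′)) _ (funToFin (table d K K′)) _ eq
      eqs′ = combine-injective (funToFin (f ∘ e)) (funToFin (f′ ∘ e)) (funToFin (g ∘ e)) (funToFin (g′ ∘ e)) (proj₂ eqs)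

      sameTable : ∀ z → table d H H′ z ≡ table d K K′ z
      sameTable = funToFin-injective (proj₁ eqs)

      f≗g : ∀ i → f (e i) ≡ g (e i)
      f≗g = funToFin-injective (proj₁ eqs′)

      f′≗g′ : ∀ i → f′ (e i) ≡ g′ (e i)
      f′≗g′ = funToFin-injective (proj₂ eqs′)

      ≢none : ∀ {x y} → x ≡ decode y → x ≢ none
      ≢none {y = y} eq eq′ = decode-≢none y (trans (≡-sym eq) eq′)

      by-order : φ y ≡ χ y
      by-order with <-cmp (e (σ y)) (e (τ y))
      ... | tri≈ _ u≡v _ = contradiction u≡v (adj⇒≢ G (adj y))
      ... | tri< lt _ _ = decode-injective d
        (trans (≡-sym hφ) (trans (table-determines-upper d H H′ K K′ sameTable (≢none hφ) (≢none hχ)) hχ))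
        where
        hφ = upLab φ y lt
        hχ : lab K (f (e (σ y))) (f (e (τ y))) ≡ decode (χ y)
        hχ = trans (cong₂ (lab K) (f≗g (σ y)) (f≗g (τ y))) (upLab χ y lt)
      ... | tri> _ _ gt = decode-injective d
        (trans (≡-sym hφ) (trans (table-determines-lower d H H′ K K′ sameTable (≢none hφ) (≢none hχ)) hχ))
        where
        hφ = downLab φ y gt
        hχ : lab K′ (f′ (e (σ y))) (f′ (e (τ y))) ≡ decode (χ y)
        hχ = trans (cong₂ (lab K′) (f′≗g′ (σ y)) (f′≗g′ (τ y))) (downLab χ y gt)

  -- A choice of labels for the ordered pairs amounts to two labellings of G, one
  -- for increasing and one for decreasing pairs. Of the two targets it suffices
  -- to know one triangle each, so that together they fill a single k × k table.
  labellings-bound : p ^ E ≤ p ^ (k * k) * (k ^ s * k ^ s)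
  labellings-bound = injective⇒≤ {f = λ z → code (finToFun z)}
    λ eq → finToFun-injective {E} (code-injective _ _ eq)

-- Peeling off vertices of small degree

-- `Few` keeps the injection itself: it later numbers the edges at a peeled vertex, and all edges of
-- `G` when `k * k ≤ 2 * m + n`.
Few Many : ∀ {s} → (Fin s → Set) → ℕ → Set
Few {s} P D = Σ (∀ j → P j → Fin D) λ g → ∀ {i j} p q → g i p ≡ g j q → i ≡ j
Many {s} P D = Σ (Fin D → Fin s) λ h → Injective _≡_ _≡_ h × ∀ c → P (h c)

few-or-many : ∀ {s} {P : Fin s → Set} → (∀ j → Dec (P j)) → ∀ D → Few P D ⊎ Many P (suc D)
few-or-many {zero} P? D = inj₁ ((λ ()) , λ {})
few-or-many {suc s} {P} P? D with P? zero
few-or-many {suc s} {P} P? D | no ¬p₀ with few-or-many (P? ∘ suc) D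
... | inj₁ (g , g-inj) = inj₁ (g′ , λ {i} {j} → g′-inj {i} {j})
  where
  g′ : ∀ j → P j → Fin D
  g′ zero    p = contradiction p ¬p₀
  g′ (suc j) p = g j p
  g′-inj : ∀ {i j} p q → g′ i p ≡ g′ j q → i ≡ j
  g′-inj {zero}          p q eq = contradiction p ¬p₀
  g′-inj {suc _} {zero}  p q eq = contradiction q ¬p₀
  g′-inj {suc _} {suc _} p q eq = cong suc (g-inj p q eq)
... | inj₂ (h , h-inj , all) = inj₂ (suc ∘ h , (λ eq → h-inj (suc-injective eq)) , all)
few-or-many {suc s} {P} P? zero | yes p₀ =
  inj₂ ((λ _ → zero) , (λ { {zero} {zero} _ → refl }) , λ _ → p₀)
few-or-many {suc s} {P} P? (suc D) | yes p₀ with few-or-many (P? ∘ suc) D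
... | inj₁ (g , g-inj) = inj₁ (g′ , λ {i} {j} → g′-inj {i} {j})
  where
  g′ : ∀ j → P j → Fin (suc D)
  g′ zero    p = zero
  g′ (suc j) p = suc (g j p)
  g′-inj : ∀ {i j} p q → g′ i p ≡ g′ j q → i ≡ j
  g′-inj {zero}  {zero}  p q eq = refl
  g′-inj {suc _} {suc _} p q eq = cong suc (g-inj p q (suc-injective eq))
... | inj₂ (h , h-inj , all) = inj₂ (h′ , (λ {i} {j} → h′-inj {i} {j}) , all′)
  where
  h′ : Fin (suc (suc D)) → Fin (suc s)
  h′ zero    = zero
  h′ (suc c) = suc (h c)
  h′-inj : ∀ {i j} → h′ i ≡ h′ j → i ≡ j
  h′-inj {zero}  {zero}  eq = refl
  h′-inj {suc _} {suc _} eq = cong suc (h-inj (suc-injective eq))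
  all′ : ∀ c → P (h′ c)
  all′ zero    = p₀
  all′ (suc c) = all c

some-or-all : ∀ {s} {A B : Fin s → Set} → (∀ i → A i ⊎ B i) → ∃ A ⊎ (∀ i → B i)
some-or-all {zero} _ = inj₂ λ ()
some-or-all {suc s} {A} {B} f with f zero | some-or-all (f ∘ suc)
... | inj₁ a | _            = inj₁ (zero , a)
... | inj₂ _ | inj₁ (i , a) = inj₁ (suc i , a)
... | inj₂ b | inj₂ bs      = inj₂ λ { zero → b ; (suc i) → bs i }

-- no-fan rules out monochromatic cycles outside the core; all it uses of a cycle is
-- that each vertex w i has two distinct neighbours w (a i), w (b i) on it.
record Peeling {s : ℕ} (R : Fin s → Fin s → Set) (B D : ℕ) : Set where
  field
    core      : Fin s → Maybe (Fin B)
    core-inj  : ∀ {u v c} → core u ≡ just c → core v ≡ just c → u ≡ v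
    class     : Fin s → Fin s → Fin D
    class-sym : ∀ u v → class u v ≡ class v u
    no-fan    : ∀ {L} (w : Fin (suc L) → Fin s) (a b : Fin (suc L) → Fin (suc L)) →
      (∀ i → core (w i) ≡ nothing) →
      (∀ i → R (w i) (w (a i))) → (∀ i → R (w i) (w (b i))) → (∀ i → w (a i) ≢ w (b i)) →
      ¬ (∀ i → class (w i) (w (a i)) ≡ class (w i) (w (b i)))

module _ {B D : ℕ} (d : Fin D) where

  allCore : ∀ {s} {R : Fin s → Fin s → Set} → s ≤ B → Peeling R B D
  allCore s≤B = record
    { core      = λ u → just (inject≤ u s≤B)
    ; core-inj  = λ {u} {v} p q → inject≤-injective s≤B s≤B u v (just-injective (trans p (≡-sym q)))
    ; class     = λ _ _ → d
    ; class-sym = λ _ _ → refl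
    ; no-fan    = λ w a b outside _ _ _ _ → contradiction (outside zero) λ ()
    }

  -- Edges at the peeled vertex i get pairwise distinct classes.
  module _ {s : ℕ} {R : Fin (suc s) → Fin (suc s) → Set} (R? : ∀ u v → Dec (R u v))
    (i : Fin (suc s)) (few : Few (R i) D)
    (P : Peeling (λ u v → R (punchIn i u) (punchIn i v)) B D) where

    private
      module P = Peeling P

      slotDec : ∀ {v} → Dec (R i v) → Fin D
      slotDec (yes r) = proj₁ few _ r
      slotDec (no _)  = d

      slot : Fin (suc s) → Fin D
      slot v = slotDec (R? i v)

      slotDec-inj : ∀ {v v′} → R i v → R i v′ → (d : Dec (R i v)) (d′ : Dec (R i v′)) →
        slotDec d ≡ slotDec d′ → v ≡ v′
      slotDec-inj _ _  (yes r) (yes r′) eq = proj₂ few r r′ eq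
      slotDec-inj r _  (no ¬r) _        _  = contradiction r ¬r
      slotDec-inj _ r′ (yes _) (no ¬r′) _  = contradiction r′ ¬r′

      coreDec : ∀ {u} → Dec (i ≡ u) → Maybe (Fin B)
      coreDec (yes _)  = nothing
      coreDec (no i≢u) = P.core (punchOut i≢u)

      coreDec-inj : ∀ {u v c} (d : Dec (i ≡ u)) (d′ : Dec (i ≡ v)) →
        coreDec d ≡ just c → coreDec d′ ≡ just c → u ≡ v
      coreDec-inj (no i≢u) (no i≢v) p q = punchOut-injective i≢u i≢v (P.core-inj p q)

      -- An edge with a peeled end is numbered at whichever end is peeled first.
      classDec : ∀ {u v} → Dec (i ≡ u) → Dec (i ≡ v) → Fin D
      classDec {v = v} (yes _)  _         = slot v
      classDec {u = u} (no _)   (yes _)   = slot u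
      classDec         (no i≢u) (no i≢v) = P.class (punchOut i≢u) (punchOut i≢v)

      classDec-sym : ∀ {u v} (d : Dec (i ≡ u)) (d′ : Dec (i ≡ v)) → classDec d d′ ≡ classDec d′ d
      classDec-sym (yes refl) (yes refl) = refl
      classDec-sym (yes _)    (no _)     = refl
      classDec-sym (no _)     (yes _)    = refl
      classDec-sym (no _)     (no _)     = P.class-sym _ _

      classDec-slot : ∀ {u v} (d : Dec (i ≡ u)) (d′ : Dec (i ≡ v)) → i ≡ u → classDec d d′ ≡ slot v
      classDec-slot (yes _)  _ _   = refl
      classDec-slot (no i≢u) _ i≡u = contradiction i≡u i≢u

      coreDec-punchOut : ∀ {u} (d : Dec (i ≡ u)) (i≢u : i ≢ u) →
        coreDec d ≡ P.core (punchOut i≢u)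
      coreDec-punchOut (yes i≡u) i≢u  = contradiction i≡u i≢u
      coreDec-punchOut (no i≢u)  i≢u′ = cong P.core (punchOut-cong i refl)

      classDec-punchOut : ∀ {u v} (d : Dec (i ≡ u)) (d′ : Dec (i ≡ v)) (i≢u : i ≢ u) (i≢v : i ≢ v) →
        classDec d d′ ≡ P.class (punchOut i≢u) (punchOut i≢v)
      classDec-punchOut (yes i≡u) _         i≢u _   = contradiction i≡u i≢u
      classDec-punchOut (no _)    (yes i≡v) _   i≢v = contradiction i≡v i≢v
      classDec-punchOut (no _)    (no _)    _   _   =
        cong₂ P.class (punchOut-cong i refl) (punchOut-cong i refl)

    addPeeled : Peeling R B D
    addPeeled = record
      { core      = λ u → coreDec (i ≟ u)
      ; core-inj  = λ {u} {v} → coreDec-inj (i ≟ u) (i ≟ v)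
      ; class     = λ u v → classDec (i ≟ u) (i ≟ v)
      ; class-sym = λ u v → classDec-sym (i ≟ u) (i ≟ v)
      ; no-fan    = no-fan
      }
      where
      no-fan : ∀ {L} (w : Fin (suc L) → Fin (suc s)) (a b : Fin (suc L) → Fin (suc L)) →
        (∀ j → coreDec (i ≟ w j) ≡ nothing) →
        (∀ j → R (w j) (w (a j))) → (∀ j → R (w j) (w (b j))) → (∀ j → w (a j) ≢ w (b j)) →
        ¬ (∀ j → classDec (i ≟ w j) (i ≟ w (a j)) ≡ classDec (i ≟ w j) (i ≟ w (b j)))
      no-fan w a b outside Ra Rb a≢b same with any? (λ j → i ≟ w j)
      -- If `i` occurs as `w j`, its two distinct neighbours `w (a j)` and `w (b j)` would share a
      -- slot.
      ... | yes (j , i≡wj) = a≢b j (slotDec-inj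
              (subst (λ u → R u (w (a j))) (≡-sym i≡wj) (Ra j))
              (subst (λ u → R u (w (b j))) (≡-sym i≡wj) (Rb j))
              (R? i (w (a j))) (R? i (w (b j)))
              (trans (≡-sym (classDec-slot (i ≟ w j) (i ≟ w (a j)) i≡wj))
                (trans (same j) (classDec-slot (i ≟ w j) (i ≟ w (b j)) i≡wj))))
      -- Otherwise all of `w` lies among the remaining vertices, where `P` applies.
      ... | no misses = P.no-fan w′ a b
              (λ j → trans (≡-sym (coreDec-punchOut (i ≟ w j) (i≢ j))) (outside j))
              (λ j → subst₂ R (≡-sym (punchIn-punchOut (i≢ j))) (≡-sym (punchIn-punchOut (i≢ (a j)))) (Ra j))
              (λ j → subst₂ R (≡-sym (punchIn-punchOut (i≢ j))) (≡-sym (punchIn-punchOut (i≢ (b j)))) (Rb j))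
              (λ j eq → a≢b j (punchOut-injective (i≢ (a j)) (i≢ (b j)) eq))
              (λ j → trans (≡-sym (classDec-punchOut (i ≟ w j) (i ≟ w (a j)) (i≢ j) (i≢ (a j))))
                (trans (same j) (classDec-punchOut (i ≟ w j) (i ≟ w (b j)) (i≢ j) (i≢ (b j)))))
        where
        i≢ : ∀ j → i ≢ w j
        i≢ j eq = misses (j , eq)
        w′ = λ j → punchOut (i≢ j)

  -- While more than `B` vertices remain, not all of them have more than `D` remaining neighbours,
  -- so one can be peeled. Sparsity is assumed for every vertex subset because the recursion
  -- replaces `e` by `e ∘ punchIn i`.
  peel : ∀ {N} {R : Fin N → Fin N → Set} → (∀ u v → Dec (R u v)) →
    (∀ {s} (e : Fin s → Fin N) → Injective _≡_ _≡_ e → B < s →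
      ¬ (∀ i → Many (λ j → R (e i) (e j)) (suc D))) →
    ∀ {s} (e : Fin s → Fin N) → Injective _≡_ _≡_ e → Peeling (λ i j → R (e i) (e j)) B D
  peel R? sparse {zero}  e e-inj = allCore z≤n
  peel R? sparse {suc s} e e-inj with suc s ℕ.≤? B
  ... | yes s≤B = allCore s≤B
  ... | no s≰B with some-or-all (λ i → few-or-many (λ j → R? (e i) (e j)) D)
  ...   | inj₂ many      = contradiction many (sparse e e-inj (ℕ.≰⇒> s≰B))
  ...   | inj₁ (i , few) = addPeeled (λ u v → R? (e u) (e v)) i few
            (peel R? sparse (e ∘ punchIn i) (λ eq → punchIn-injective i _ _ (e-inj eq)))

-- Cycles

prev : ∀ {L} → Fin (suc L) → Fin (suc L)
prev zero    = fromℕ _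
prev (suc i) = inject₁ i

next : ∀ {L} → Fin (suc L) → Fin (suc L)
next i with view i
... | ‵fromℕ             = zero
... | ‵inj₁ {i = j} _ = suc j

next-fromℕ : ∀ L → next (fromℕ L) ≡ zero
next-fromℕ L rewrite view-fromℕ L = refl

next-inject₁ : ∀ {L} (i : Fin L) → next (inject₁ i) ≡ suc i
next-inject₁ i rewrite view-inject₁ i = refl

next-prev : ∀ {L} (i : Fin (suc L)) → next (prev i) ≡ i
next-prev zero    = next-fromℕ _
next-prev (suc i) = next-inject₁ i

-- The minimal cycle length three enters here: in a cyclic order of two elements both neighbours
-- coincide.
prev≢next : ∀ {L} (i : Fin (3 + L)) → prev i ≢ next i
prev≢next i eq with view i
prev≢next {L} _ () | ‵fromℕ
prev≢next _ () | ‵inj₁ {i = zero} _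
prev≢next _ eq | ‵inj₁ {i = suc j} _ = ℕ.m≢1+n+m (toℕ j) {1} (trans
  (≡-sym (trans (toℕ-inject₁ (inject₁ j)) (toℕ-inject₁ j))) (cong toℕ eq))

other-colour : ∀ {A : Set} {a b x y z : A} → x ≡ a ⊎ x ≡ b → y ≡ a ⊎ y ≡ b → z ≡ a ⊎ z ≡ b →
  x ≢ z → y ≢ z → x ≡ y
other-colour (inj₁ refl) (inj₁ refl) _           _   _   = refl
other-colour (inj₂ refl) (inj₂ refl) _           _   _   = refl
other-colour (inj₁ refl) (inj₂ refl) (inj₁ refl) x≢z _   = contradiction refl x≢z
other-colour (inj₁ refl) (inj₂ refl) (inj₂ refl) _   y≢z = contradiction refl y≢z
other-colour (inj₂ refl) (inj₁ refl) (inj₁ refl) _   y≢z = contradiction refl y≢z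
other-colour (inj₂ refl) (inj₁ refl) (inj₂ refl) x≢z _   = contradiction refl x≢z

module _ {N : ℕ} {G : SimpleGraph N} (C : Cycle G) where

  adj-next : ∀ i → Adj G (vs C i) (vs C (next i))
  adj-next i with view i
  ... | ‵fromℕ          = close C
  ... | ‵inj₁ {i = j} _ = step C j

  adj-prev : ∀ i → Adj G (vs C i) (vs C (prev i))
  adj-prev i = sym G (subst (λ j → Adj G (vs C (prev i)) (vs C j)) (next-prev i) (adj-next (prev i)))

  vs-prev≢next : ∀ i → vs C (prev i) ≢ vs C (next i)
  vs-prev≢next i eq = prev≢next i (inj C eq)

  -- Both neighbours avoid the colour of the middle vertex, and only one other colour is available.
  bicoloured-prev≡next : ∀ {c} (col : Fin N → Fin c) → (∀ u v → Adj G u v → col u ≢ col v) →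
    ∀ {a b} → (∀ i → col (vs C i) ≡ a ⊎ col (vs C i) ≡ b) → ∀ i → col (vs C (prev i)) ≡ col (vs C (next i))
  bicoloured-prev≡next col proper two i = other-colour (two (prev i)) (two (next i)) (two i)
    (λ eq → proper _ _ (adj-prev i) (≡-sym eq)) (λ eq → proper _ _ (adj-next i) (≡-sym eq))

-- Colouring a peeled graph

module _ {N B K D : ℕ} (G : SimpleGraph N) (P : Peeling (Adj G) B D) (col₀ : Fin N → Fin K)
  (proper₀ : ∀ {u v} → Adj G u v → col₀ u ≢ col₀ v)
  (separates₀ : ∀ {u v v′} → Adj G u v → Adj G u v′ → col₀ v ≡ col₀ v′ →
    Peeling.class P u v ≡ Peeling.class P u v′) where

  open Peeling P

  private
    colMaybe : Maybe (Fin B) → Fin K → Fin (B + K)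
    colMaybe (just x) _ = x ↑ˡ K
    colMaybe nothing  y = B ↑ʳ y

    col : Fin N → Fin (B + K)
    col u = colMaybe (core u) (col₀ u)

    ↑ˡ≢↑ʳ : ∀ (x : Fin B) (y : Fin K) → x ↑ˡ K ≢ B ↑ʳ y
    ↑ˡ≢↑ʳ x y eq with () ← trans (≡-sym (splitAt-↑ˡ B x K)) (trans (cong (splitAt B) eq) (splitAt-↑ʳ B K y))

    col-cases : ∀ u v → col u ≡ col v →
      u ≡ v ⊎ (core u ≡ nothing × core v ≡ nothing × col₀ u ≡ col₀ v)
    col-cases u v eq with core u in cu | core v in cv
    ... | just x  | just y  = inj₁ (core-inj cu (trans cv (cong just (≡-sym (↑ˡ-injective K x y eq)))))
    ... | just x  | nothing = contradiction eq (↑ˡ≢↑ʳ x _)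
    ... | nothing | just y  = contradiction (≡-sym eq) (↑ˡ≢↑ʳ y _)
    ... | nothing | nothing = inj₂ (refl , refl , ↑ʳ-injective B _ _ eq)

    proper : ∀ u v → Adj G u v → col u ≢ col v
    proper u v a eq with col-cases u v eq
    ... | inj₁ u≡v           = adj⇒≢ G a u≡v
    ... | inj₂ (_ , _ , eq₀) = proper₀ a eq₀

  -- On a bicoloured cycle each vertex shares its colour with a different vertex two steps away, so
  -- none lies in the core. Then `separates₀` puts the two edges at each vertex into one class,
  -- which `no-fan` forbids.
  peeling⇒acyclic : Σ (Fin N → Fin (B + K)) (IsAcyclicColoring G (B + K))
  peeling⇒acyclic = col , proper , λ a b (C , two) →
    let around : ∀ i → core (vs C (prev i)) ≡ nothing × core (vs C (next i)) ≡ nothing ×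
                       col₀ (vs C (prev i)) ≡ col₀ (vs C (next i))
        around i = outside C i (col-cases _ _ (bicoloured-prev≡next C col proper two i))
    in no-fan (vs C) prev next
         -- `around` speaks of neighbours, and each vertex is the successor of its predecessor.
         (λ i → subst (λ j → core (vs C j) ≡ nothing) (next-prev i) (proj₁ (proj₂ (around (prev i)))))
         (adj-prev C) (adj-next C) (vs-prev≢next C)
         (λ i → separates₀ (adj-prev C i) (adj-next C i) (proj₂ (proj₂ (around i))))
    where
    outside : ∀ (C : Cycle G) i {Q : Set} → vs C (prev i) ≡ vs C (next i) ⊎ Q → Q
    outside C i (inj₁ eq) = contradiction eq (vs-prev≢next C i)
    outside C i (inj₂ q)  = q

-- Sparsity of large subgraphs and the bound for `k ≤ p ^ (2 ^ t)`

module _ {m n N k : ℕ} (G : SimpleGraph N) (adj? : ∀ u v → Dec (Adj G u v))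
  (realize : Realizable m n G k) (p≥2 : 2 ≤ 2 * m + n) where

  private
    p : ℕ
    p = 2 * m + n

  -- With `2 * q + 1` neighbours everywhere there are `s * (2 * q + 1)` ordered pairs, but
  -- `labellings-bound` and `k ≤ p ^ q` allow at most `k * k + 2 * q * s`. This would give
  -- `s ≤ k ^ 2`.
  large⇒low-degree : ∀ q → k ≤ p ^ q → ∀ {s} (e : Fin s → Fin N) → Injective _≡_ _≡_ e → k ^ 2 < s →
    ¬ (∀ i → Many (λ j → Adj G (e i) (e j)) (suc (2 * q)))
  large⇒low-degree q k≤p^q {s} e e-inj k²<s many = ℕ.<⇒≱ too-many bound
    where
    nb : Fin s → Fin (suc (2 * q)) → Fin s
    nb i = proj₁ (many i)

    σ τ : Fin (s * suc (2 * q)) → Fin s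
    σ y = proj₁ (remQuot {s} (suc (2 * q)) y)
    τ y = nb (σ y) (proj₂ (remQuot {s} (suc (2 * q)) y))

    nb-injective : ∀ {i i′ c c′} → i ≡ i′ → nb i c ≡ nb i′ c′ → (i , c) ≡ (i′ , c′)
    nb-injective {i} refl eq = cong (i ,_) (proj₁ (proj₂ (many i)) eq)

    bound : p ^ (s * suc (2 * q)) ≤ p ^ (k * k + (q * s + q * s))
    bound = begin
      p ^ (s * suc (2 * q))                  ≤⟨ labellings-bound G realize (inject≤ zero p≥2) e σ τ
                                                  (λ y → proj₂ (proj₂ (many (σ y))) _)
                                                  (λ eq eq′ → remQuot-injective {s} _ (nb-injective (e-inj eq) (e-inj eq′))) ⟩
      p ^ (k * k) * (k ^ s * k ^ s)          ≤⟨ ℕ.*-monoʳ-≤ (p ^ (k * k)) (ℕ.*-mono-≤ k^s≤ k^s≤) ⟩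
      p ^ (k * k) * (p ^ (q * s) * p ^ (q * s)) ≡⟨ cong (p ^ (k * k) *_) (≡-sym (ℕ.^-distribˡ-+-* p (q * s) (q * s))) ⟩
      p ^ (k * k) * p ^ (q * s + q * s)      ≡⟨ ≡-sym (ℕ.^-distribˡ-+-* p (k * k) _) ⟩
      p ^ (k * k + (q * s + q * s))          ∎
      where
      open ℕ.≤-Reasoning
      k^s≤ : k ^ s ≤ p ^ (q * s)
      k^s≤ = ℕ.≤-trans (ℕ.^-monoˡ-≤ s k≤p^q) (ℕ.≤-reflexive (ℕ.^-*-assoc p q s))

    too-many : p ^ (k * k + (q * s + q * s)) < p ^ (s * suc (2 * q))
    too-many = ℕ.^-monoʳ-< p p≥2 (begin-strict
      k * k + (q * s + q * s) ≡⟨ cong₂ _+_ (cong (k *_) (≡-sym (ℕ.*-identityʳ k))) (rearrange q s) ⟩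
      k ^ 2 + s * (2 * q)     <⟨ ℕ.+-monoˡ-< (s * (2 * q)) k²<s ⟩
      s + s * (2 * q)         ≡⟨ ≡-sym (ℕ.*-suc s (2 * q)) ⟩
      s * suc (2 * q)         ∎)
      where
      open ℕ.≤-Reasoning
      rearrange : ∀ q s → q * s + q * s ≡ s * (2 * q)
      rearrange = solve-∀

  acyclic-large-k : ∀ t → k ≤ p ^ (2 ^ t) → AcyclicChiLe G (k ^ 2 + k ^ (2 + t))
  acyclic-large-k t k≤ =
    _ , ℕ.≤-refl , peeling⇒acyclic G peeling (proj₁ sep) (proj₁ (proj₂ sep)) (proj₂ (proj₂ sep))
    where
    -- `2 * 2 ^ t` is `2 ^ suc t` by definition: the classes have `suc t` bits, and with the
    -- constant labelling `separate` uses `2 + t` homomorphisms. The element passed to `peel` is an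
    -- arbitrary class.
    peeling : Peeling (Adj G) (k ^ 2) (2 ^ suc t)
    peeling = peel (funToFin {suc t} λ _ → zero) adj? (large⇒low-degree (2 ^ t) k≤) id id
    sep = separate G realize p≥2 {suc t} (Peeling.class peeling) (Peeling.class-sym peeling)

-- Few vertices of positive degree when k² ≤ p

module _ {m n : ℕ} where

  private
    plain⊎ : Fin m ⊎ Fin n → Label m n
    plain⊎ (inj₁ i) = arcOut i
    plain⊎ (inj₂ j) = edge j

    plain⊎-injective : ∀ {x y} → plain⊎ x ≡ plain⊎ y ⊎ plain⊎ x ≡ rev (plain⊎ y) → x ≡ y
    plain⊎-injective {inj₁ _} {inj₁ _} (inj₁ refl) = refl
    plain⊎-injective {inj₁ _} {inj₁ _} (inj₂ ())
    plain⊎-injective {inj₁ _} {inj₂ _} (inj₂ ())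
    plain⊎-injective {inj₂ _} {inj₂ _} (inj₁ refl) = refl
    plain⊎-injective {inj₂ _} {inj₂ _} (inj₂ refl) = refl

  plain : Fin (m + n) → Label m n
  plain c = plain⊎ (splitAt m c)

  plain-≢none : ∀ c → plain c ≢ none
  plain-≢none c eq with splitAt m c
  plain-≢none c () | inj₁ _
  plain-≢none c () | inj₂ _

  -- Two edges may land on one target edge in opposite directions, so a label must also differ from
  -- the reverses of the others. Taking only outgoing arcs achieves this with `m + n` labels.
  plain-injective : ∀ {x y} → plain x ≡ plain y ⊎ plain x ≡ rev (plain y) → x ≡ y
  plain-injective {x} {y} eq = trans (≡-sym (join-splitAt m n x))
    (trans (cong (Fin.join m n) (plain⊎-injective eq)) (join-splitAt m n y))

-- Give the E edges pairwise different colours; then their images, read in both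
-- directions, are distinct ordered pairs of distinct vertices of the target.
distinct-edges-bound : ∀ {m n N k E} (G : SimpleGraph N) → Realizable m n G (suc k) → Fin (m + n) →
  E ≤ m + n → (src tgt : Fin E → Fin N) → (∀ y → src y Fin.< tgt y) → (∀ y → Adj G (src y) (tgt y)) →
  (∀ {x y} → src x ≡ src y → tgt x ≡ tgt y → x ≡ y) → 2 * E ≤ suc k * k
distinct-edges-bound {m} {n} {N} {k} {E} G realize default E≤ src tgt src<tgt adj jointly-injective =
  injective⇒≤ {f = λ z → image (remQuot {2} E z)} λ {x} {y} eq →
    remQuot-injective {2} E (image-injective (remQuot {2} E x) (remQuot {2} E y) eq)
  where
  open Extend src tgt jointly-injective default

  ℓ : Fin N → Fin N → Label m n
  ℓ u v = plain (extend (λ y → inject≤ y E≤) u v)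

  real : Realization G (suc k) ℓ
  real = realize ℓ λ u v → plain-≢none (extend (λ y → inject≤ y E≤) u v)

  H = proj₁ real
  f = proj₁ (proj₂ real)

  label : ∀ y → lab H (f (src y)) (f (tgt y)) ≡ plain (inject≤ y E≤)
  label y = trans (proj₂ (proj₂ real) (adj y))
    (trans (orient-< ℓ (src<tgt y)) (cong plain (extend-hit _ y)))

  label-rev : ∀ y → lab H (f (tgt y)) (f (src y)) ≡ rev (plain (inject≤ y E≤))
  label-rev y = trans (lab-rev H _ _) (cong rev (label y))

  f-src≢f-tgt : ∀ y → f (src y) ≢ f (tgt y)
  f-src≢f-tgt y eq = plain-≢none (inject≤ y E≤) (trans (≡-sym (label y))
    (trans (cong (λ x → lab H x (f (tgt y))) eq) (lab-irr H _)))

  -- The first component picks the direction of reading; `punchOut` removes the diagonal, leaving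
  -- `suc k * k` ordered pairs.
  image : Fin 2 × Fin E → Fin (suc k * k)
  image (zero     , y) = combine (f (src y)) (punchOut (f-src≢f-tgt y))
  image (suc zero , y) = combine (f (tgt y)) (punchOut (f-src≢f-tgt y ∘ ≡-sym))

  off-diagonal : ∀ {a b c d : Fin (suc k)} (a≢b : a ≢ b) (c≢d : c ≢ d) →
    combine a (punchOut a≢b) ≡ combine c (punchOut c≢d) → a ≡ c × b ≡ d
  off-diagonal {a} {b} {c} {d} a≢b c≢d eq with combine-injective a _ c _ eq
  ... | refl , eq′ = refl , punchOut-injective a≢b c≢d eq′

  same-label : ∀ {x y} → plain {m} {n} (inject≤ x E≤) ≡ plain (inject≤ y E≤) ⊎
    plain {m} {n} (inject≤ x E≤) ≡ rev (plain (inject≤ y E≤)) → x ≡ y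
  same-label {x} {y} eq = inject≤-injective E≤ E≤ x y (plain-injective eq)

  -- The labels of the two edges force `x ≡ y`, and then the ends of this edge would have the same
  -- image.
  crossed : ∀ x y → f (src x) ≡ f (tgt y) → f (tgt x) ≡ f (src y) → ⊥
  crossed x y p q = f-src≢f-tgt y (trans (≡-sym (cong (f ∘ src) x≡y)) p)
    where
    x≡y = same-label {x} {y}
      (inj₂ (trans (≡-sym (label x)) (trans (cong₂ (lab H) p q) (label-rev y))))

  image-injective : ∀ x y → image x ≡ image y → x ≡ y
  image-injective (zero , x) (zero , y) eq =
    let (p , q) = off-diagonal (f-src≢f-tgt x) (f-src≢f-tgt y) eq in
    cong (zero ,_) (same-label (inj₁ (trans (≡-sym (label x)) (trans (cong₂ (lab H) p q) (label y)))))
  image-injective (suc zero , x) (suc zero , y) eq =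
    let (p , q) = off-diagonal (f-src≢f-tgt x ∘ ≡-sym) (f-src≢f-tgt y ∘ ≡-sym) eq in
    cong (suc zero ,_) (same-label (inj₁ (trans (≡-sym (label x)) (trans (cong₂ (lab H) q p) (label y)))))
  image-injective (zero , x) (suc zero , y) eq =
    let (p , q) = off-diagonal (f-src≢f-tgt x) (f-src≢f-tgt y ∘ ≡-sym) eq in ⊥-elim (crossed x y p q)
  image-injective (suc zero , x) (zero , y) eq =
    let (p , q) = off-diagonal (f-src≢f-tgt x ∘ ≡-sym) (f-src≢f-tgt y) eq in ⊥-elim (crossed x y q p)

module _ {N : ℕ} (G : SimpleGraph N) (adj? : ∀ u v → Dec (Adj G u v)) where

  IncreasingEdge : Fin (N * N) → Set
  IncreasingEdge z = let (u , v) = remQuot {N} N z in u Fin.< v × Adj G u v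

  increasingEdge? : ∀ z → Dec (IncreasingEdge z)
  increasingEdge? z = let (u , v) = remQuot {N} N z in (u <? v) ×-dec adj? u v

  module _ {D : ℕ} (few : Few IncreasingEdge D) where

    private
      index : ∀ {u v} → u Fin.< v → Adj G u v → Fin D
      index {u} {v} lt a = proj₁ few (combine u v)
        (subst (λ (u , v) → u Fin.< v × Adj G u v) (≡-sym (remQuot-combine u v)) (lt , a))

      index-injective : ∀ {u v u′ v′} (lt : u Fin.< v) (a : Adj G u v) (lt′ : u′ Fin.< v′) (a′ : Adj G u′ v′) →
        index lt a ≡ index lt′ a′ → u ≡ u′ × v ≡ v′
      index-injective {u} {v} {u′} {v′} lt a lt′ a′ eq =
        combine-injective u v u′ v′ (proj₂ few _ _ eq)

      -- This is a half-edge: the index of the edge and a bit telling whether `u` is its lower or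
      -- upper end. It determines `u`.
      end : ∀ {u v} → Adj G u v → Fin (2 * D)
      end {u} {v} a with <-cmp u v
      ... | tri< lt _ _  = combine {2} zero (index lt a)
      ... | tri≈ _ u≡v _ = contradiction u≡v (adj⇒≢ G a)
      ... | tri> _ _ gt  = combine {2} (suc zero) (index gt (sym G a))

      end-injective : ∀ {u v u′ v′} (a : Adj G u v) (a′ : Adj G u′ v′) → end a ≡ end a′ → u ≡ u′
      end-injective {u} {v} {u′} {v′} a a′ eq with <-cmp u v | <-cmp u′ v′
      ... | tri≈ _ u≡v _ | _            = contradiction u≡v (adj⇒≢ G a)
      ... | tri< _ _ _   | tri≈ _ eq′ _ = contradiction eq′ (adj⇒≢ G a′)
      ... | tri> _ _ _   | tri≈ _ eq′ _ = contradiction eq′ (adj⇒≢ G a′)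
      ... | tri< lt _ _  | tri< lt′ _ _ = proj₁ (index-injective lt a lt′ a′
              (combine-injectiveʳ {2} zero (index lt a) zero (index lt′ a′) eq))
      ... | tri> _ _ gt  | tri> _ _ gt′ = proj₂ (index-injective gt (sym G a) gt′ (sym G a′)
              (combine-injectiveʳ {2} (suc zero) (index gt (sym G a)) (suc zero) (index gt′ (sym G a′)) eq))
      ... | tri< lt _ _  | tri> _ _ gt′ =
              contradiction (combine-injectiveˡ {2} zero (index lt a) (suc zero) (index gt′ (sym G a′)) eq) λ ()
      ... | tri> _ _ gt  | tri< lt′ _ _ =
              contradiction (combine-injectiveˡ {2} (suc zero) (index gt (sym G a)) zero (index lt′ a′) eq) λ ()

      -- Whichever neighbour is found, the half-edge identifies `u`; isolated vertices, which lie on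
      -- no cycle, share `zero`.
      colDec : ∀ {u} → Dec (∃ (Adj G u)) → Fin (suc (2 * D))
      colDec (yes (_ , a)) = suc (end a)
      colDec (no _)        = zero

      col : Fin N → Fin (suc (2 * D))
      col u = colDec (any? (adj? u))

      colDec-injective : ∀ {u v u′ v′} → Adj G u u′ → Adj G v v′ →
        (d : Dec (∃ (Adj G u))) (d′ : Dec (∃ (Adj G v))) → colDec d ≡ colDec d′ → u ≡ v
      colDec-injective _ _  (yes (_ , a)) (yes (_ , a′)) eq = end-injective a a′ (suc-injective eq)
      colDec-injective a _  (no ¬a)       _              _  = contradiction (_ , a) ¬a
      colDec-injective _ a′ (yes _)       (no ¬a′)       _  = contradiction (_ , a′) ¬a′

      col-injective : ∀ {u v u′ v′} → Adj G u u′ → Adj G v v′ → col u ≡ col v → u ≡ v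
      col-injective {u} {v} a a′ = colDec-injective a a′ (any? (adj? u)) (any? (adj? v))

      proper : ∀ u v → Adj G u v → col u ≢ col v
      proper u v a eq = adj⇒≢ G a (col-injective a (sym G a) eq)

    -- Non-isolated vertices have distinct colours, whereas a bicoloured cycle repeats one on the
    -- two neighbours of a vertex.
    few-edges⇒acyclic : Σ (Fin N → Fin (suc (2 * D))) (IsAcyclicColoring G (suc (2 * D)))
    few-edges⇒acyclic = col , proper , λ a b (C , two) → vs-prev≢next C zero
      (col-injective (sym G (adj-prev C zero)) (sym G (adj-next C zero))
        (bicoloured-prev≡next C col proper two zero))

  module _ {m n k : ℕ} (realize : Realizable m n G k) (k≥4 : 4 ≤ k) (k²≤p : k * k ≤ 2 * m + n) where

    private
      h r : ℕ
      h = k * k / 2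
      r = k * k % 2

      k²≡ : k * k ≡ r + h * 2
      k²≡ = m≡m%n+[m/n]*n (k * k) 2

      2h≤k² : 2 * h ≤ k * k
      2h≤k² = begin
        2 * h     ≡⟨ ℕ.*-comm 2 h ⟩
        h * 2     ≤⟨ ℕ.m≤n+m (h * 2) r ⟩
        r + h * 2 ≡⟨ ≡-sym k²≡ ⟩
        k * k     ∎
        where open ℕ.≤-Reasoning

      k²≤1+2h : k * k ≤ 1 + 2 * h
      k²≤1+2h = begin
        k * k     ≡⟨ k²≡ ⟩
        r + h * 2 ≤⟨ ℕ.+-mono-≤ (s≤s⁻¹ (m%n<n (k * k) 2)) (ℕ.≤-reflexive (ℕ.*-comm h 2)) ⟩
        1 + 2 * h ∎
        where open ℕ.≤-Reasoning

      -- Halving absorbs the double weight of arc colours in `2 * m + n`, so `h` edges can receive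
      -- distinct colours.
      h≤m+n : h ≤ m + n
      h≤m+n = ℕ.*-cancelˡ-≤ 2 (begin
        2 * h         ≤⟨ 2h≤k² ⟩
        k * k         ≤⟨ k²≤p ⟩
        2 * m + n     ≤⟨ ℕ.+-monoʳ-≤ (2 * m) (ℕ.m≤m+n n (n + 0)) ⟩
        2 * m + 2 * n ≡⟨ ≡-sym (ℕ.*-distribˡ-+ 2 m n) ⟩
        2 * (m + n)   ∎)
        where open ℕ.≤-Reasoning

      -- Read in both directions, `h` edges would occupy `2 * h ≥ k * k - 1` of the `k * (k - 1)`
      -- ordered pairs off the diagonal, so `k ≤ 1`.
      few-edges : ∀ {D} → h ≡ suc D → Many IncreasingEdge (suc D) → ⊥
      few-edges {D} h≡ (z , z-injective , edge-z) = absurd k refl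
        where
        src tgt : Fin (suc D) → Fin N
        src y = proj₁ (remQuot {N} N (z y))
        tgt y = proj₂ (remQuot {N} N (z y))

        jointly-injective : ∀ {x y} → src x ≡ src y → tgt x ≡ tgt y → x ≡ y
        jointly-injective {x} {y} p q = z-injective (remQuot-injective {N} N (cong₂ _,_ p q))

        1+D≤m+n : suc D ≤ m + n
        1+D≤m+n = subst (_≤ m + n) h≡ h≤m+n

        absurd : ∀ j → k ≡ j → ⊥
        absurd zero    refl = contradiction k≥4 λ ()
        absurd (suc j) refl = ℕ.<⇒≱ (ℕ.≤-trans (s≤s (s≤s z≤n)) k≥4) (ℕ.+-cancelʳ-≤ (2 * h) k 1 (begin
          k + 2 * h       ≡⟨ cong (λ x → k + 2 * x) h≡ ⟩
          k + 2 * suc D   ≤⟨ ℕ.+-monoʳ-≤ k (distinct-edges-bound G realize (inject≤ zero 1+D≤m+n) 1+D≤m+n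
                               src tgt (proj₁ ∘ edge-z) (proj₂ ∘ edge-z) jointly-injective) ⟩
          k + k * j       ≡⟨ ≡-sym (ℕ.*-suc k j) ⟩
          k * k           ≤⟨ k²≤1+2h ⟩
          1 + 2 * h       ∎))
          where open ℕ.≤-Reasoning

    acyclic-small-k : AcyclicChiLe G (k ^ 2)
    acyclic-small-k = by-half h refl
      where
      open ℕ.≤-Reasoning
      by-half : ∀ j → h ≡ j → AcyclicChiLe G (k ^ 2)
      by-half zero h≡0 = contradiction (begin
        4         ≤⟨ k≥4 ⟩
        k         ≤⟨ ℕ.m≤m*n k k ⦃ >-nonZero (ℕ.≤-trans (s≤s z≤n) k≥4) ⦄ ⟩
        k * k     ≤⟨ k²≤1+2h ⟩
        1 + 2 * h ≡⟨ cong (λ x → 1 + 2 * x) h≡0 ⟩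
        1         ∎) λ { (s≤s ()) }
      by-half (suc D) h≡ with few-or-many increasingEdge? D
      ... | inj₂ many = ⊥-elim (few-edges h≡ many)
      -- At most `D = h - 1` edges exist, so the `1 + 2 * D` colours are fewer than `2 * h`.
      ... | inj₁ few  = suc (2 * D) , (begin
        suc (2 * D) ≤⟨ ℕ.m≤n+m _ 1 ⟩
        2 + 2 * D   ≡⟨ ≡-sym (ℕ.*-suc 2 D) ⟩
        2 * suc D   ≡⟨ cong (2 *_) (≡-sym h≡) ⟩
        2 * h       ≤⟨ 2h≤k² ⟩
        k * k       ≡⟨ cong (k *_) (≡-sym (ℕ.*-identityʳ k)) ⟩
        k ^ 2       ∎) , few-edges⇒acyclic few

-- The two signs of the iterated logarithm

theorem4 : ∀ (m n : ℕ) → 2 ≤ 2 * m + n →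
    ∀ {N : ℕ} (G : SimpleGraph N) (k : ℕ) → ChiIs m n G k → 4 ≤ k →
    ∀ (t : ℤ) → IsCeilLog2LogP (2 * m + n) k t →
    AcyclicChiLe G (k ^ 2 + floorPow k (+ 2 ℤ.+ t))
theorem4 m n p≥2 G k chi k≥4 (+ a) (k≤ , _) =
  acyclic-large-k G (chiIs⇒adj? {G = G} chi) (chiIs⇒realizable G chi) p≥2 a k≤
-- For negative `t` the summand `k ^ 2` alone bounds the number of colours.
theorem4 m n p≥2 G k chi k≥4 -[1+ s ] (k≤ , _) =
  let (c , c≤ , col) = acyclic-small-k G (chiIs⇒adj? {G = G} chi) (chiIs⇒realizable G chi) k≥4 k²≤p in
  c , ℕ.≤-trans c≤ (ℕ.m≤m+n (k ^ 2) _) , col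
  where
  k²≤p : k * k ≤ 2 * m + n
  k²≤p = begin
    k * k         ≡⟨ cong (k *_) (≡-sym (ℕ.*-identityʳ k)) ⟩
    k ^ 2         ≤⟨ ℕ.^-monoʳ-≤ k ⦃ >-nonZero (ℕ.≤-trans (s≤s z≤n) k≥4) ⦄ (ℕ.^-monoʳ-≤ 2 {1} {suc s} (s≤s z≤n)) ⟩
    k ^ (2 ^ suc s) ≤⟨ k≤ ⟩
    2 * m + n     ∎
    where open ℕ.≤-Reasoning
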